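{- Let $\mathcal{H}$ be an $r$-uniform hypergraph with $r\geq 3$ and $\Delta(\mathcal{H})=2$. Then $\tau(\mathcal{H})\leq (r-1)\cdot \nu(\mathcal{H})$.
   Context: A hypergraph $\mathcal{H}=(V,E)$ has a finite vertex set $V$ and a multiset $E$ of subsets of $V$; it is $r$-uniform if every hyperedge has exactly $r$ vertices. $\tau(\mathcal{H})=\min\{|T|: T\subseteq V,\ T\cap f\neq\emptyset\ \forall f\in E\}$; $\nu(\mathcal{H})$ is the maximum number of pairwise disjoint hyperedges; $\Delta(\mathcal{H})$ is the maximum number of hyperedges containing a common vertex. -}

module Defs where

open import Data.Nat using (ℕ; _≤_; _≥_)
open import Data.Fin using (Fin)
open import Data.Fin.Subset using (Subset; _∈_; ∣_∣; _∩_; Empty)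
open import Data.Fin.Subset.Properties using (_∈?_)
open import Data.List using (List; length; filter; lookup)
open import Data.Product using (Σ; _×_; ∃; ∃-syntax)
open import Relation.Binary.PropositionalEquality using (_≡_)
open import Relation.Nullary using (¬_)

-- A hypergraph on vertex set Fin n: a list (multiset) of hyperedges,
-- each hyperedge being a subset of the vertex set.
record Hypergraph : Set where
  constructor mkHypergraph
  field
    n     : ℕ
    edges : List (Subset n)
open Hypergraph public

-- the i-th hyperedge (edges indexed by position, so repetitions are distinct)
edge : (H : Hypergraph) → Fin (length (edges H)) → Subset (n H)
edge H i = lookup (edges H) i

Uniform : ℕ → Hypergraph → Set
Uniform r H = ∀ i → ∣ edge H i ∣ ≡ r

degree : (H : Hypergraph) → Fin (n H) → ℕ
degree H v = length (filter (λ e → v ∈? e) (edges H))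

MaxDegree : Hypergraph → ℕ → Set
MaxDegree H d = (∀ v → degree H v ≤ d) × (∃[ v ] degree H v ≡ d)

Transversal : (H : Hypergraph) → Subset (n H) → Set
Transversal H T = ∀ i → ¬ Empty (T ∩ edge H i)

IsTau : Hypergraph → ℕ → Set
IsTau H t = (∃[ T ] (Transversal H T × ∣ T ∣ ≡ t))
          × (∀ T → Transversal H T → t ≤ ∣ T ∣)

Matching : (H : Hypergraph) → Subset (length (edges H)) → Set
Matching H M = ∀ i j → i ∈ M → j ∈ M → ¬ (i ≡ j) → Empty (edge H i ∩ edge H j)

IsNu : Hypergraph → ℕ → Set
IsNu H k = (∃[ M ] (Matching H M × ∣ M ∣ ≡ k))
         × (∀ M → Matching H M → ∣ M ∣ ≤ k)

{-# OPTIONS --safe #-}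
module Submission where

-- View the hyperedges as the vertices of a graph, adjacent when they intersect.  As Δ ≤ 2, distinct
-- neighbours of v meet v in distinct vertices, so all degrees are at most r; matchings are independent
-- sets, and the closed neighbourhood of v is hit by max(1, deg v) vertices of v.  By induction on the set A
-- of hyperedges, build an independent I and a cover T of A with |T| ≤ (r - 1)|I|: if deg v < r, or if v
-- lies in a triangle (whose other two corners share a vertex), deleting the closed neighbourhood of v
-- costs at most r - 1.
-- The remaining case, A triangle-free and r-regular, costs r for the first deletion.  This is repaid
-- because a triangle-free A with a vertex of degree < r admits |T| + 1 ≤ (r - 1)|I|: keep deleting
-- vertices of degree < r until the rest is empty or r-regular.  No edge can then lead into the rest, so
-- the last deleted v may be replaced in I by its (independent) neighbours.

open import Defs
open import Data.Nat using (ℕ; zero; suc; _+_; _≤_; _<_; _∸_; _*_; _⊔_; _<?_; z≤n; s≤s)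
open import Data.Nat.Properties
  using (≤-refl; ≤-reflexive; ≤-trans; <-≤-trans; <⇒≢; >⇒≢; ≮⇒≥; 1+n≰n; n≤1+n; +-suc; +-comm; +-assoc; +-identityʳ;
         +-mono-≤; +-monoʳ-≤; +-monoˡ-≤; *-identityʳ; *-distribˡ-+; *-monoʳ-≤; *-monoˡ-≤; ∸-monoˡ-≤; m+[n∸m]≡n;
         m≤n⊔m; ⊔-lub; module ≤-Reasoning)
open import Data.Bool using (true; false)
open import Data.Fin using (Fin; zero; suc; _≟_)
open import Data.Fin.Properties using () renaming (any? to anyFin?)
open import Data.Fin.Subset using (Subset; inside; outside; _∈_; ∣_∣; _∪_; _-_; ⁅_⁆; ⋃; Nonempty)
open import Data.Fin.Subset.Properties
  using (_∈?_; nonempty?; Empty-unique; ∣⊥∣≡0; ∣⁅x⁆∣≡1; ∉⊥; x∈⁅x⁆; x∈⁅y⁆⇒x≡y;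
         x∈p∪q⁺; x∈p∪q⁻; x∈p∩q⁺; x∈p∩q⁻; x∈p∧x≢y⇒x∈p-y; x∈p⇒∣p-x∣<∣p∣)
open import Data.List using (List; []; _∷_; _++_; length; filter; lookup; map; allFin)
open import Data.List.Properties using (length-++; filter-notAll)
open import Data.List.Membership.Propositional using (find; lose) renaming (_∈_ to _∈ˡ_; _∉_ to _∉ˡ_)
open import Data.List.Membership.Propositional.Properties
  using (∈-filter⁺; ∈-filter⁻; ∈-allFin; ∈-++⁺ˡ; ∈-++⁺ʳ; ∈-++⁻)
open import Data.List.Relation.Binary.Subset.Propositional using (_⊆_)
open import Data.List.Relation.Unary.All as All using (All; []; _∷_)
open import Data.List.Relation.Unary.AllPairs using ([]; _∷_)
open import Data.List.Relation.Unary.Any using (Any; here; there; any?)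
open import Data.List.Relation.Unary.Unique.Propositional using (Unique)
import Data.List.Relation.Unary.Unique.Propositional.Properties as Unique
open import Data.Product using (_×_; _,_; proj₁; proj₂; ∃-syntax)
open import Data.Sum using (_⊎_; inj₁; inj₂; [_,_]′)
open import Data.Empty using (⊥-elim)
open import Data.Vec using ([]; _∷_; here; there)
open import Function using (_∘_)
open import Relation.Binary.PropositionalEquality
open import Relation.Nullary using (¬_; Dec; yes; no; does; contradiction; ¬?; _×-dec_)
open import Relation.Unary using (Decidable)

-- Counting with finite subsets

-- Induction on `xs`: the representative of the head is removed from `p`, and injectivity keeps the
-- other representatives away from it. `R` is a relation because representatives are only known to
-- exist.
length≤∣p∣ : ∀ {a ℓ} {A : Set a} {n} (R : A → Fin n → Set ℓ) {p : Subset n} {xs : List A} →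
             (∀ {i j x} → i ∈ˡ xs → j ∈ˡ xs → R i x → R j x → i ≡ j) →
             Unique xs → (∀ {i} → i ∈ˡ xs → ∃[ x ] x ∈ p × R i x) → length xs ≤ ∣ p ∣
length≤∣p∣ R {xs = []} inj uniq rep = z≤n
length≤∣p∣ R {p} {i ∷ xs} inj (i∉ ∷ uniq) rep with rep (here refl)
... | x , x∈p , Rix =
  ≤-trans (s≤s (length≤∣p∣ R (λ u v → inj (there u) (there v)) uniq rep′)) (x∈p⇒∣p-x∣<∣p∣ x∈p)
  where
  rep′ : ∀ {j} → j ∈ˡ xs → ∃[ y ] y ∈ p - x × R j y
  rep′ j∈ with rep (there j∈)
  ... | y , y∈p , Rjy = y , x∈p∧x≢y⇒x∈p-y y∈p y≢x , Rjy
    where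
    y≢x : y ≢ x
    y≢x refl = All.lookup i∉ j∈ (inj (here refl) (there j∈) Rix Rjy)

module _ {a ℓ} {A : Set a} {P : A → Set ℓ} (P? : Decidable P) where

  -- `degree` is the length of a filtered list, while hyperedges are identified by position; this
  -- subset links the two counts.
  positions : (xs : List A) → Subset (length xs)
  positions []       = []
  positions (x ∷ xs) = does (P? x) ∷ positions xs

  ∣positions∣ : ∀ xs → ∣ positions xs ∣ ≡ length (filter P? xs)
  ∣positions∣ []       = refl
  ∣positions∣ (x ∷ xs) with does (P? x)
  ... | true  = cong suc (∣positions∣ xs)
  ... | false = ∣positions∣ xs

  ∈-positions : ∀ xs i → P (lookup xs i) → i ∈ positions xs
  ∈-positions (x ∷ xs) zero    px with P? x
  ... | yes _  = here
  ... | no ¬px = contradiction px ¬px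
  ∈-positions (x ∷ xs) (suc i) px = there (∈-positions xs i px)

∣p∪q∣≤∣p∣+∣q∣ : ∀ {n} (p q : Subset n) → ∣ p ∪ q ∣ ≤ ∣ p ∣ + ∣ q ∣
∣p∪q∣≤∣p∣+∣q∣ []            []            = z≤n
∣p∪q∣≤∣p∣+∣q∣ (outside ∷ p) (outside ∷ q) = ∣p∪q∣≤∣p∣+∣q∣ p q
∣p∪q∣≤∣p∣+∣q∣ (outside ∷ p) (inside ∷ q)  =
  ≤-trans (s≤s (∣p∪q∣≤∣p∣+∣q∣ p q)) (≤-reflexive (sym (+-suc ∣ p ∣ ∣ q ∣)))
∣p∪q∣≤∣p∣+∣q∣ (inside ∷ p)  (outside ∷ q) = s≤s (∣p∪q∣≤∣p∣+∣q∣ p q)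
∣p∪q∣≤∣p∣+∣q∣ (inside ∷ p)  (inside ∷ q)  =
  s≤s (≤-trans (∣p∪q∣≤∣p∣+∣q∣ p q) (+-monoʳ-≤ ∣ p ∣ (n≤1+n ∣ q ∣)))

-- Passing between lists and subsets

module _ {n : ℕ} where

  fromList : List (Fin n) → Subset n
  fromList xs = ⋃ (map ⁅_⁆ xs)

  ∈-fromList⁺ : ∀ {x xs} → x ∈ˡ xs → x ∈ fromList xs
  ∈-fromList⁺ {x} (here refl) = x∈p∪q⁺ (inj₁ (x∈⁅x⁆ x))
  ∈-fromList⁺ (there x∈)      = x∈p∪q⁺ (inj₂ (∈-fromList⁺ x∈))

  ∈-fromList⁻ : ∀ {x} xs → x ∈ fromList xs → x ∈ˡ xs
  ∈-fromList⁻ []       x∈ = contradiction x∈ ∉⊥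
  ∈-fromList⁻ (y ∷ xs) x∈ =
    [ here ∘ x∈⁅y⁆⇒x≡y y , there ∘ ∈-fromList⁻ xs ]′ (x∈p∪q⁻ ⁅ y ⁆ (fromList xs) x∈)

  ∣fromList∣≤length : ∀ xs → ∣ fromList xs ∣ ≤ length xs
  ∣fromList∣≤length []       = ≤-reflexive (∣⊥∣≡0 n)
  ∣fromList∣≤length (x ∷ xs) =
    ≤-trans (∣p∪q∣≤∣p∣+∣q∣ ⁅ x ⁆ (fromList xs)) (+-mono-≤ (≤-reflexive (∣⁅x⁆∣≡1 x)) (∣fromList∣≤length xs))

  length≤∣fromList∣ : ∀ {xs} → Unique xs → length xs ≤ ∣ fromList xs ∣
  length≤∣fromList∣ uniq =
    length≤∣p∣ _≡_ (λ _ _ i≡x j≡x → trans i≡x (sym j≡x)) uniq (λ i∈ → _ , ∈-fromList⁺ i∈ , refl)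

∣p∣>0⇒nonempty : ∀ {n} {p : Subset n} → 0 < ∣ p ∣ → Nonempty p
∣p∣>0⇒nonempty {n} {p} 0<∣p∣ with nonempty? p
... | yes ne = ne
... | no  em = contradiction (trans (cong ∣_∣ (Empty-unique em)) (∣⊥∣≡0 n)) (>⇒≢ 0<∣p∣)

-- The intersection graph of the hyperedges

module DualGraph
  {m n r : ℕ} (3≤r : 3 ≤ r) (E : Fin m → Subset n) (uniform : ∀ i → ∣ E i ∣ ≡ r)
  (degree≤2 : ∀ {x i j k} → x ∈ E i → x ∈ E j → x ∈ E k → i ≢ j → i ≢ k → ¬ (j ≢ k))
  where

  Adj : Fin m → Fin m → Set
  Adj i j = i ≢ j × ∃[ x ] (x ∈ E i × x ∈ E j)

  Adj? : ∀ i j → Dec (Adj i j)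
  Adj? i j = ¬? (i ≟ j) ×-dec anyFin? (λ x → (x ∈? E i) ×-dec (x ∈? E j))

  Adj-sym : ∀ {i j} → Adj i j → Adj j i
  Adj-sym (i≢j , x , x∈i , x∈j) = i≢j ∘ sym , x , x∈j , x∈i

  Covers : List (Fin n) → List (Fin m) → Set
  Covers T A = ∀ {i} → i ∈ˡ A → ∃[ x ] (x ∈ˡ T × x ∈ E i)

  Independent : List (Fin m) → Set
  Independent I = ∀ {i j} → i ∈ˡ I → j ∈ˡ I → ¬ Adj i j

  TriangleFree : List (Fin m) → Set
  TriangleFree A = ∀ {i j k} → i ∈ˡ A → j ∈ˡ A → k ∈ˡ A → Adj i j → Adj i k → ¬ Adj j k

  nbrs : List (Fin m) → Fin m → List (Fin m)
  nbrs A v = filter (Adj? v) A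

  Deficient : List (Fin m) → Fin m → Set
  Deficient A v = length (nbrs A v) < r

  -- For `A` without repetitions degrees never exceed `r`, so this is `r`-regularity; the empty list
  -- is full.
  Full : List (Fin m) → Set
  Full A = ∀ {v} → v ∈ˡ A → ¬ Deficient A v

  full⊎deficient : ∀ A → Full A ⊎ (∃[ v ] (v ∈ˡ A × Deficient A v))
  full⊎deficient A with any? (λ v → length (nbrs A v) <? r) A
  ... | yes any = inj₂ (find any)
  ... | no none = inj₁ (λ v∈A d → none (lose v∈A d))

  1≤r∸1 : 1 ≤ r ∸ 1
  1≤r∸1 = ≤-trans (s≤s z≤n) (∸-monoˡ-≤ 1 3≤r)

  2≤r∸1 : 2 ≤ r ∸ 1
  2≤r∸1 = ∸-monoˡ-≤ 1 3≤r

  1+[r∸1]≡r : 1 + (r ∸ 1) ≡ r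
  1+[r∸1]≡r = m+[n∸m]≡n (≤-trans (s≤s z≤n) 3≤r)

  -- A vertex of `E v` shared by two neighbours would lie in three hyperedges. `L` is arbitrary so
  -- that `full-closed` can add a neighbour from outside `A`.
  length-adjacent≤r : ∀ {v L} → Unique L → (∀ {i} → i ∈ˡ L → Adj v i) → length L ≤ r
  length-adjacent≤r {v} {L} uniq adj =
    ≤-trans (length≤∣p∣ (λ i x → x ∈ E v × x ∈ E i) inj uniq rep) (≤-reflexive (uniform v))
    where
    inj : ∀ {i j x} → i ∈ˡ L → j ∈ˡ L → x ∈ E v × x ∈ E i → x ∈ E v × x ∈ E j → i ≡ j
    inj {i} {j} i∈ j∈ (x∈v , x∈i) (_ , x∈j) with i ≟ j
    ... | yes i≡j = i≡j
    ... | no  i≢j = ⊥-elim (degree≤2 x∈v x∈i x∈j (proj₁ (adj i∈)) (proj₁ (adj j∈)) i≢j)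
    rep : ∀ {i} → i ∈ˡ L → ∃[ x ] x ∈ E v × (x ∈ E v × x ∈ E i)
    rep i∈ with adj i∈
    ... | _ , x , x∈v , x∈i = x , x∈v , x∈v , x∈i

  -- Otherwise i would have r neighbours in A and a further one, j.
  full-closed : ∀ {A i j} → Unique A → Full A → i ∈ˡ A → j ∉ˡ A → ¬ Adj j i
  full-closed {A} {i} {j} uniq full i∈A j∉A j~i =
    full i∈A (length-adjacent≤r {i} (All.tabulate j≢ ∷ Unique.filter⁺ (Adj? i) uniq) adj)
    where
    j≢ : ∀ {k} → k ∈ˡ nbrs A i → j ≢ k
    j≢ k∈ refl = j∉A (proj₁ (∈-filter⁻ (Adj? i) {xs = A} k∈))
    adj : ∀ {k} → k ∈ˡ j ∷ nbrs A i → Adj i k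
    adj (here refl) = Adj-sym j~i
    adj (there k∈)  = proj₂ (∈-filter⁻ (Adj? i) {xs = A} k∈)

  -- Covering closed neighbourhoods

  -- One shared vertex is chosen per neighbour. All of these lie in `E v`, so they also cover `v`,
  -- unless `L` is empty and one vertex of `E v` must be supplied: hence `1 ⊔`.
  covers-star : ∀ v L → (∀ {i} → i ∈ˡ L → Adj v i) →
                ∃[ S ] (Covers S (v ∷ L) × length S ≤ 1 ⊔ length L)
  covers-star v [] adj with ∣p∣>0⇒nonempty (subst (0 <_) (sym (uniform v)) (≤-trans (s≤s z≤n) 3≤r))
  ... | x , x∈v = x ∷ [] , (λ { (here refl) → x , here refl , x∈v }) , ≤-refl
  covers-star v (i ∷ L) adj = go (i ∷ L) adj (s≤s z≤n)
    where
    spokes : ∀ L → (∀ {i} → i ∈ˡ L → Adj v i) →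
             ∃[ S ] (Covers S L × length S ≡ length L × All (_∈ E v) S)
    spokes [] adj = [] , (λ ()) , refl , []
    spokes (i ∷ L) adj with adj (here refl) | spokes L (adj ∘ there)
    ... | _ , x , x∈v , x∈i | S , cov , eq , S⊆v =
      x ∷ S ,
      (λ { (here refl) → x , here refl , x∈i
         ; (there j∈) → let y , y∈ , y∈j = cov j∈ in y , there y∈ , y∈j }) ,
      cong suc eq , x∈v ∷ S⊆v
    go : ∀ L → (∀ {i} → i ∈ˡ L → Adj v i) → 0 < length L →
         ∃[ S ] (Covers S (v ∷ L) × length S ≤ 1 ⊔ length L)
    go L adj 0<L with spokes L adj
    ... | [] , cov , eq , _ = contradiction eq (<⇒≢ 0<L)
    ... | S@(x ∷ _) , cov , eq , x∈v ∷ _ =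
      S , (λ { (here refl) → x , here refl , x∈v ; (there i∈) → cov i∈ }) ,
      ≤-trans (≤-reflexive eq) (m≤n⊔m 1 (length L))

  -- The vertex `x` common to `i` and `j` covers both, which saves one vertex over the star of `v`
  -- when `L` has `r` elements.
  covers-triangle : ∀ v L → (∀ {i} → i ∈ˡ L → Adj v i) → length L ≤ r →
                    ∀ {i j} → i ∈ˡ L → j ∈ˡ L → Adj i j →
                    ∃[ S ] (Covers S (v ∷ L) × length S ≤ r ∸ 1)
  covers-triangle v L adj L≤r {i} {j} i∈L j∈L (i≢j , x , x∈i , x∈j)
    = x ∷ S , cov′ , bound
    where
    L′ = filter (λ k → ¬? (k ≟ i)) L
    L″ = filter (λ k → ¬? (k ≟ j)) L′
    L″⊆L : L″ ⊆ L
    L″⊆L k∈ = proj₁ (∈-filter⁻ (λ k → ¬? (k ≟ i)) {xs = L}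
                    (proj₁ (∈-filter⁻ (λ k → ¬? (k ≟ j)) {xs = L′} k∈)))
    star = covers-star v L″ (λ k∈ → adj (L″⊆L k∈))
    S    = proj₁ star
    cov  = proj₁ (proj₂ star)
    S≤   = proj₂ (proj₂ star)
    cov′ : Covers (x ∷ S) (v ∷ L)
    cov′ (here refl) = let y , y∈ , y∈v = cov (here refl) in y , there y∈ , y∈v
    cov′ {k} (there k∈) with k ≟ i | k ≟ j
    ... | yes refl | _ = x , here refl , x∈i
    ... | no _ | yes refl = x , here refl , x∈j
    ... | no k≢i | no k≢j =
      let y , y∈ , y∈k = cov (there (∈-filter⁺ (λ k → ¬? (k ≟ j)) (∈-filter⁺ (λ k → ¬? (k ≟ i)) k∈ k≢i) k≢j))
      in y , there y∈ , y∈k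
    j∈L′ : j ∈ˡ L′
    j∈L′ = ∈-filter⁺ (λ k → ¬? (k ≟ i)) j∈L (i≢j ∘ sym)
    2+L″≤r : 2 + length L″ ≤ r
    2+L″≤r = ≤-trans (s≤s (filter-notAll (λ k → ¬? (k ≟ j)) L′ (lose j∈L′ (λ ¬≡ → ¬≡ refl))))
             (≤-trans (filter-notAll (λ k → ¬? (k ≟ i)) L (lose i∈L (λ ¬≡ → ¬≡ refl))) L≤r)
    bound : suc (length S) ≤ r ∸ 1
    -- Adding two to `1 ⊔ length L″` gives `3 ⊔ (2 + length L″)`; the `3` stems from an empty `L″`
    -- and is bounded by `3≤r`.
    bound = ∸-monoˡ-≤ 1 (≤-trans (s≤s (s≤s S≤)) (⊔-lub {r} {3} {2 + length L″} 3≤r 2+L″≤r))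

  -- Packings and their extension

  -- slack is the amount by which |T| ≤ (r - 1)|I| can be improved.
  record Packing (A : List (Fin m)) (slack : ℕ) : Set where
    field
      I           : List (Fin m)
      unique      : Unique I
      I⊆A         : I ⊆ A
      independent : Independent I
      T           : List (Fin n)
      covers      : Covers T A
      bound       : length T + slack ≤ (r ∸ 1) * length I

  weaken : ∀ {A c} → Packing A c → Packing A 0
  weaken p = record
    { Packing p
    ; bound = ≤-trans (+-monoʳ-≤ (length (Packing.T p)) z≤n) (Packing.bound p)
    }

  -- The slack `c′` on `B` and `r - 1` per element of `J` pay for `S` and the new slack `c`. `J` is
  -- a list, as it will be either `v` alone or all neighbours of `v`.
  extend : ∀ {A B J S c c′} → Packing B c′ → B ⊆ A → J ⊆ A → Unique J → Independent J →
           (∀ {i j} → i ∈ˡ B → j ∈ˡ J → i ≢ j × ¬ Adj j i) →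
           (∀ {i} → i ∈ˡ A → i ∈ˡ B ⊎ ∃[ x ] (x ∈ˡ S × x ∈ E i)) →
           length S + c ≤ c′ + (r ∸ 1) * length J → Packing A c
  extend {A} {B} {J} {S} {c} {c′} p B⊆A J⊆A uJ indJ apart covS le = record
    { I           = I ++ J
    ; unique      = Unique.++⁺ unique uJ (λ (i∈I , i∈J) → proj₁ (apart (I⊆A i∈I) i∈J) refl)
    ; I⊆A         = [ B⊆A ∘ I⊆A , J⊆A ]′ ∘ ∈-++⁻ I
    ; independent = ind
    ; T           = T ++ S
    ; covers      = cov
    ; bound       = bd
    }
    where
    open Packing p
    ind : Independent (I ++ J)
    ind i∈ j∈ with ∈-++⁻ I i∈ | ∈-++⁻ I j∈
    ... | inj₁ i∈I | inj₁ j∈I = independent i∈I j∈I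
    ... | inj₁ i∈I | inj₂ j∈J = proj₂ (apart (I⊆A i∈I) j∈J) ∘ Adj-sym
    ... | inj₂ i∈J | inj₁ j∈I = proj₂ (apart (I⊆A j∈I) i∈J)
    ... | inj₂ i∈J | inj₂ j∈J = indJ i∈J j∈J
    cov : Covers (T ++ S) A
    cov i∈A with covS i∈A
    ... | inj₁ i∈B = let x , x∈ , x∈i = covers i∈B in x , ∈-++⁺ˡ x∈ , x∈i
    ... | inj₂ (x , x∈ , x∈i) = x , ∈-++⁺ʳ T x∈ , x∈i
    open ≤-Reasoning
    bd : length (T ++ S) + c ≤ (r ∸ 1) * length (I ++ J)
    bd = begin
      length (T ++ S) + c                            ≡⟨ cong (_+ c) (length-++ T) ⟩
      length T + length S + c                        ≡⟨ +-assoc (length T) (length S) c ⟩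
      length T + (length S + c)                      ≤⟨ +-monoʳ-≤ (length T) le ⟩
      length T + (c′ + (r ∸ 1) * length J)           ≡⟨ +-assoc (length T) c′ _ ⟨
      length T + c′ + (r ∸ 1) * length J             ≤⟨ +-monoˡ-≤ _ bound ⟩
      (r ∸ 1) * length I + (r ∸ 1) * length J        ≡⟨ *-distribˡ-+ (r ∸ 1) (length I) (length J) ⟨
      (r ∸ 1) * (length I + length J)                ≡⟨ cong ((r ∸ 1) *_) (length-++ I) ⟨
      (r ∸ 1) * length (I ++ J)                      ∎

  -- Deleting the closed neighbourhood of `v`, leaving `B`

  module Delete (A : List (Fin m)) (uniq : Unique A) {v : Fin m} (v∈A : v ∈ˡ A) where

    N : List (Fin m)
    N = nbrs A v

    Far : Fin m → Set
    Far i = v ≢ i × ¬ Adj v i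

    Far? : Decidable Far
    Far? i = ¬? (v ≟ i) ×-dec ¬? (Adj? v i)

    B : List (Fin m)
    B = filter Far? A

    B⊆A : B ⊆ A
    B⊆A = proj₁ ∘ ∈-filter⁻ Far? {xs = A}

    far : ∀ {i} → i ∈ˡ B → Far i
    far = proj₂ ∘ ∈-filter⁻ Far? {xs = A}

    N⊆A : N ⊆ A
    N⊆A = proj₁ ∘ ∈-filter⁻ (Adj? v) {xs = A}

    adj : ∀ {i} → i ∈ˡ N → Adj v i
    adj = proj₂ ∘ ∈-filter⁻ (Adj? v) {xs = A}

    uniqueB : Unique B
    uniqueB = Unique.filter⁺ Far? uniq

    uniqueN : Unique N
    uniqueN = Unique.filter⁺ (Adj? v) uniq

    N≤r : length N ≤ r
    N≤r = length-adjacent≤r uniqueN adj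

    shrinks : length B < length A
    shrinks = filter-notAll Far? A (lose v∈A (λ f → proj₁ f refl))

    covers-rest : ∀ {S} → Covers S (v ∷ N) → ∀ {i} → i ∈ˡ A → i ∈ˡ B ⊎ ∃[ x ] (x ∈ˡ S × x ∈ E i)
    covers-rest cov {i} i∈A with v ≟ i | Adj? v i
    ... | yes refl | _       = inj₂ (cov (here refl))
    ... | no _     | yes v~i = inj₂ (cov (there (∈-filter⁺ (Adj? v) i∈A v~i)))
    ... | no v≢i   | no ¬v~i = inj₁ (∈-filter⁺ Far? i∈A (v≢i , ¬v~i))

    extend-vertex : ∀ {S c c′} → Packing B c′ → Covers S (v ∷ N) →
                    length S + c ≤ c′ + (r ∸ 1) → Packing A c
    extend-vertex {c′ = c′} p cov le =
      extend p B⊆A [v]⊆A ([] ∷ []) ind apart (covers-rest cov)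
        (≤-trans le (+-monoʳ-≤ c′ (≤-reflexive (sym (*-identityʳ (r ∸ 1))))))
      where
      [v]⊆A : v ∷ [] ⊆ A
      [v]⊆A (here refl) = v∈A
      ind : Independent (v ∷ [])
      ind (here refl) (here refl) (v≢v , _) = v≢v refl
      apart : ∀ {i j} → i ∈ˡ B → j ∈ˡ v ∷ [] → i ≢ j × ¬ Adj j i
      apart i∈B (here refl) = proj₁ (far i∈B) ∘ sym , proj₂ (far i∈B)

    -- `N` is independent by triangle-freeness and has no edge into `B` by `full-closed`. It earns
    -- `r - 1 ≥ 2` per element while its star costs one per element, so a surplus of at least one
    -- remains.
    extend-nbrs : Packing B 0 → Full B → TriangleFree A → 0 < length N → Packing A 1
    extend-nbrs p full tf 0<N with covers-star v N adj
    ... | S , cov , S≤ = extend p B⊆A N⊆A uniqueN ind apart (covers-rest cov) le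
      where
      ind : Independent N
      ind i∈N j∈N = tf v∈A (N⊆A i∈N) (N⊆A j∈N) (adj i∈N) (adj j∈N)
      ∉B : ∀ {j} → j ∈ˡ N → j ∉ˡ B
      ∉B j∈N j∈B = proj₂ (far j∈B) (adj j∈N)
      apart : ∀ {i j} → i ∈ˡ B → j ∈ˡ N → i ≢ j × ¬ Adj j i
      apart i∈B j∈N = (λ { refl → ∉B j∈N i∈B }) , full-closed uniqueB full i∈B (∉B j∈N)
      open ≤-Reasoning
      le : length S + 1 ≤ (r ∸ 1) * length N
      le = begin
        length S + 1             ≤⟨ +-mono-≤ (≤-trans S≤ (⊔-lub 0<N ≤-refl)) 0<N ⟩
        length N + length N      ≡⟨ cong (length N +_) (+-identityʳ (length N)) ⟨
        2 * length N             ≤⟨ *-monoˡ-≤ (length N) 2≤r∸1 ⟩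
        (r ∸ 1) * length N       ∎

    -- An isolated `v` has no neighbours to replace it, but it costs one vertex and earns
    -- `r - 1 ≥ 2`, which again leaves one.
    extend-full : Packing B 0 → Full B → TriangleFree A → Packing A 1
    extend-full p full tf with 0 <? length N
    ... | yes 0<N = extend-nbrs p full tf 0<N
    ... | no  0≮N with covers-star v N adj
    ...   | S , cov , S≤ = extend-vertex p cov
      (≤-trans (+-monoˡ-≤ 1 (≤-trans S≤ (⊔-lub ≤-refl (≤-trans (≮⇒≥ 0≮N) z≤n)))) 2≤r∸1)

    deficient-star : Deficient A v → ∃[ S ] (Covers S (v ∷ N) × length S ≤ r ∸ 1)
    deficient-star d with covers-star v N adj
    ... | S , cov , S≤ = S , cov , ≤-trans S≤ (⊔-lub 1≤r∸1 (∸-monoˡ-≤ 1 d))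

  -- The induction

  HasTriangle : List (Fin m) → Fin m → Set
  HasTriangle A v = Any (λ i → Any (Adj i) (nbrs A v)) (nbrs A v)

  HasTriangle? : ∀ A → Decidable (HasTriangle A)
  HasTriangle? A v = any? (λ i → any? (Adj? i) (nbrs A v)) (nbrs A v)

  ¬triangle⇒triangleFree : ∀ {A} → ¬ Any (HasTriangle A) A → TriangleFree A
  ¬triangle⇒triangleFree ¬t i∈ j∈ k∈ i~j i~k j~k =
    ¬t (lose i∈ (lose (∈-filter⁺ (Adj? _) j∈ i~j) (lose (∈-filter⁺ (Adj? _) k∈ i~k) j~k)))

  -- Simultaneous induction. `B` is a filtered list, so recursion runs on the strict length bound
  -- `s`; `s = 0` is impossible.
  packing : ∀ s A → length A < s → Unique A → Packing A 0
  deficient-packing : ∀ s A → length A < s → Unique A → TriangleFree A →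
                      ∀ {v} → v ∈ˡ A → Deficient A v → Packing A 1

  packing (suc s) A (s≤s A≤s) uniq with full⊎deficient A
  ... | inj₂ (v , v∈A , d) = let S , cov , S≤ = deficient-star d in
    extend-vertex (packing s B (<-≤-trans shrinks A≤s) uniqueB) cov (≤-trans (≤-reflexive (+-identityʳ _)) S≤)
    where open Delete A uniq v∈A
  ... | inj₁ full with any? (HasTriangle? A) A
  ...   | yes triangle with find triangle
  ...     | v , v∈A , t with find t
  ...       | i , i∈N , t′ with find t′
  ...         | j , j∈N , i~j = let S , cov , S≤ = covers-triangle v N adj N≤r i∈N j∈N i~j in
    extend-vertex (packing s B (<-≤-trans shrinks A≤s) uniqueB) cov (≤-trans (≤-reflexive (+-identityʳ _)) S≤)
    where open Delete A uniq v∈A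
  packing (suc s) [] (s≤s A≤s) uniq | inj₁ full | no ¬triangle = record
    { I = [] ; unique = [] ; I⊆A = λ () ; independent = λ () ; T = [] ; covers = λ () ; bound = z≤n }
  packing (suc s) A@(v ∷ _) (s≤s A≤s) uniq | inj₁ full | no ¬triangle
    with full⊎deficient (Delete.B A uniq {v} (here refl))
  -- This includes empty `B`, which is full. The surplus from `extend-full` is dropped.
  ... | inj₁ fullB = weaken (extend-full (packing s B (<-≤-trans shrinks A≤s) uniqueB) fullB
      (¬triangle⇒triangleFree ¬triangle))
    where open Delete A uniq {v} (here refl)
  -- The star of `v` may cost `r = 1 + (r - 1)`; the extra one is paid by the slack available on
  -- `B`, where `w` is deficient.
  ... | inj₂ (w , w∈B , d) = let S , cov , S≤ = covers-star v N adj in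
    extend-vertex (deficient-packing s B (<-≤-trans shrinks A≤s) uniqueB
        (λ i∈ j∈ k∈ → ¬triangle⇒triangleFree ¬triangle (B⊆A i∈) (B⊆A j∈) (B⊆A k∈))
        w∈B d)
      cov (≤-trans (≤-reflexive (+-identityʳ _)) (≤-trans S≤
        (≤-trans (⊔-lub (≤-trans (s≤s z≤n) 3≤r) N≤r) (≤-reflexive (sym 1+[r∸1]≡r)))))
    where open Delete A uniq {v} (here refl)

  deficient-packing (suc s) A (s≤s A≤s) uniq tf {v} v∈A d with full⊎deficient (Delete.B A uniq v∈A)
  ... | inj₁ fullB = extend-full (packing s B (<-≤-trans shrinks A≤s) uniqueB) fullB tf
    where open Delete A uniq v∈A
  -- The star of the deficient `v` costs at most the `r - 1` that `v` earns, so the slack on `B`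
  -- carries over to `A`.
  ... | inj₂ (w , w∈B , dw) = let S , cov , S≤ = deficient-star d in
    extend-vertex
      (deficient-packing s B (<-≤-trans shrinks A≤s) uniqueB
        (λ i∈ j∈ k∈ → tf (B⊆A i∈) (B⊆A j∈) (B⊆A k∈)) w∈B dw)
      cov (≤-trans (≤-reflexive (+-comm _ 1)) (s≤s S≤))
    where open Delete A uniq v∈A

-- Back to hypergraphs

theorem14 : (r : ℕ) → 3 ≤ r → (H : Hypergraph) → Uniform r H → MaxDegree H 2 →
    (t k : ℕ) → IsTau H t → IsNu H k → t ≤ (r ∸ 1) * k
theorem14 r 3≤r H uniform (deg≤2 , _) t k (_ , τ-min) (_ , ν-max) = begin
  t                              ≤⟨ τ-min (fromList T) transversal ⟩
  ∣ fromList T ∣                 ≤⟨ ∣fromList∣≤length T ⟩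
  length T                       ≡⟨ +-identityʳ (length T) ⟨
  length T + 0                   ≤⟨ bound ⟩
  (r ∸ 1) * length I             ≤⟨ *-monoʳ-≤ (r ∸ 1) (length≤∣fromList∣ unique) ⟩
  (r ∸ 1) * ∣ fromList I ∣       ≤⟨ *-monoʳ-≤ (r ∸ 1) (ν-max (fromList I) matching) ⟩
  (r ∸ 1) * k                    ∎
  where
  open ≤-Reasoning
  degree≤2 : ∀ {x i j k} → x ∈ edge H i → x ∈ edge H j → x ∈ edge H k → i ≢ j → i ≢ k → ¬ (j ≢ k)
  -- Three distinct hyperedges through `x` occupy three positions, which `∣positions∣` turns into
  -- degree at least three.
  degree≤2 {x} {i} {j} {k} x∈i x∈j x∈k i≢j i≢k j≢k = 1+n≰n (begin
    3                                          ≤⟨ length≤∣p∣ _≡_ (λ _ _ p q → trans p (sym q))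
                                                    ((i≢j ∷ i≢k ∷ []) ∷ (j≢k ∷ []) ∷ [] ∷ []) incident ⟩
    ∣ positions (λ e → x ∈? e) (edges H) ∣     ≡⟨ ∣positions∣ (λ e → x ∈? e) (edges H) ⟩
    degree H x                                 ≤⟨ deg≤2 x ⟩
    2                                          ∎)
    where
    incident : ∀ {l} → l ∈ˡ i ∷ j ∷ k ∷ [] → ∃[ y ] y ∈ positions (λ e → x ∈? e) (edges H) × l ≡ y
    incident (here refl)                 = i , ∈-positions _ (edges H) i x∈i , refl
    incident (there (here refl))         = j , ∈-positions _ (edges H) j x∈j , refl
    incident (there (there (here refl))) = k , ∈-positions _ (edges H) k x∈k , refl
  open DualGraph 3≤r (edge H) uniform degree≤2
  -- The graph lives on indices, so repeated hyperedges stay distinct vertices. `≤-refl` fixes `s`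
  -- as one more than their number.
  open Packing (packing _ (allFin _) ≤-refl (Unique.allFin⁺ _))
  transversal : Transversal H (fromList T)
  transversal i empty = let x , x∈T , x∈i = covers (∈-allFin i) in empty (x , x∈p∩q⁺ (∈-fromList⁺ x∈T , x∈i))
  matching : Matching H (fromList I)
  matching i j i∈ j∈ i≢j (x , x∈) =
    independent (∈-fromList⁻ I i∈) (∈-fromList⁻ I j∈) (i≢j , x , x∈p∩q⁻ (edge H i) (edge H j) x∈)
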